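{- Let $H$ be a hypergraph with $v(H)\geq 2$. Then the quotient $H/\Pi(H)$ is an empty hypergraph, a prime hypergraph, or a complete graph (i.e. $E(H/\Pi(H))=\binom{\Pi(H)}{2}$).
   Context: All structures are finite. A hypergraph $H$ consists of a vertex set $V(H)$ and an edge set $E(H)$ which is a set of subsets of $V(H)$, each having at least $2$ elements (edges may have different sizes); $v(H)=|V(H)|$. $H$ is empty if $E(H)=\emptyset$. A subset $M$ of $V(H)$ is a module of $H$ if for each $e\in E(H)$ such that $e\cap M\neq\emptyset$ and $e\setminus M\neq\emptyset$, there exists $m\in M$ such that $e\cap M=\{m\}$ and for every $n\in M$, $(e\setminus\{m\})\cup\{n\}\in E(H)$. The sets $\emptyset$, $V(H)$ and $\{v\}$ ($v\in V(H)$) are modules, called trivial. $H$ is prime if $v(H)\geq 3$ and all its modules are trivial. A module $M$ of $H$ is strong if for every module $N$ of $H$ with $M\cap N\neq\emptyset$, we have $M\subseteq N$ or $N\subseteq M$. $\Pi(H)$ denotes the set of the strong modules of $H$ distinct from $V(H)$ that are maximal under inclusion among those; when $v(H)\geq 2$, $\Pi(H)$ is a partition of $V(H)$. For a partition $P$ of $V(H)$ into modules of $H$, the quotient $H/P$ is the hypergraph with vertex set $P$ such that $\mathcal{E}\subseteq P$ is an edge of $H/P$ iff $|\mathcal{E}|\geq 2$ and there exists $e\in E(H)$ with $\mathcal{E}=\{X\in P:X\cap e\neq\emptyset\}$. -}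

module Defs where

open import Data.Bool.Properties using () renaming (_≟_ to _≟ᵇ_)
open import Data.Fin using (Fin)
open import Data.Fin.Properties using (any?; all?)
open import Data.Fin.Subset
open import Data.Fin.Subset.Properties using (nonempty?; anySubset?; _∈?_; _⊆?_)
open import Data.List using (List; []; _∷_; _++_; map; filter; length; lookup)
import Data.List.Membership.Propositional as List
open import Data.List.Membership.Propositional.Properties
  using (∈-map⁺; ∈-map⁻; ∈-++⁺ˡ; ∈-++⁺ʳ; ∈-filter⁺; ∈-filter⁻)
open import Data.List.Relation.Unary.All using ([])
open import Data.List.Relation.Unary.AllPairs using ([]; _∷_)
open import Data.List.Relation.Unary.Any using (here)
open import Data.List.Relation.Unary.Unique.Propositional using (Unique)
import Data.List.Relation.Unary.Unique.Propositional.Properties as Unique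
open import Data.Nat using (ℕ; zero; suc; _≤_; _≤?_)
open import Data.Product using (∃; _×_; _,_; proj₁; proj₂; uncurry)
open import Data.Sum using (_⊎_)
open import Data.Vec using ([]; _∷_)
open import Data.Vec.Properties using (∷-injectiveʳ; ≡-dec)
open import Function using (_⇔_; mk⇔; Equivalence)
open import Level using (0ℓ)
open import Relation.Binary using (DecidableEquality)
open import Relation.Binary.PropositionalEquality using (_≡_; _≢_; refl)
open import Relation.Nullary using (¬_; Dec; yes; no; ¬?; _×-dec_; _⊎-dec_; _→-dec_)
open import Relation.Nullary.Decidable using (map′; decidable-stable)
open import Relation.Unary using (Pred; Decidable)

-- A finite set of subsets of a finite set is the same thing as a decidable
-- predicate on subsets; E is only ever used up to logical equivalence.
record Hypergraph : Set₁ where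
  field
    v    : ℕ
    E    : Subset v → Set
    E?   : Decidable E
    size : ∀ {e} → E e → 2 ≤ ∣ e ∣

open Hypergraph public

IsEmpty : Hypergraph → Set
IsEmpty H = ∀ e → ¬ E H e

IsCompleteGraph : Hypergraph → Set
IsCompleteGraph H = ∀ e → E H e ⇔ ∣ e ∣ ≡ 2

IsModule : (H : Hypergraph) → Subset (v H) → Set
IsModule H M =
  ∀ e → E H e → Nonempty (e ∩ M) → Nonempty (e ─ M) →
  ∃ λ m → m ∈ M × e ∩ M ≡ ⁅ m ⁆ × (∀ n → n ∈ M → E H ((e - m) ∪ ⁅ n ⁆))

IsTrivial : ∀ {n} → Subset n → Set
IsTrivial M = M ≡ ⊥ ⊎ M ≡ ⊤ ⊎ ∃ λ x → M ≡ ⁅ x ⁆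

IsPrime : Hypergraph → Set
IsPrime H = 3 ≤ v H × (∀ M → IsModule H M → IsTrivial M)

IsStrongModule : (H : Hypergraph) → Subset (v H) → Set
IsStrongModule H M =
  IsModule H M × (∀ N → IsModule H N → Nonempty (M ∩ N) → M ⊆ N ⊎ N ⊆ M)

IsProperStrongModule : (H : Hypergraph) → Subset (v H) → Set
IsProperStrongModule H M = IsStrongModule H M × M ≢ ⊤

IsMaximalStrongModule : (H : Hypergraph) → Subset (v H) → Set
IsMaximalStrongModule H M =
  IsProperStrongModule H M × (∀ N → IsProperStrongModule H N → M ⊆ N → N ≡ M)

_≟ˢ_ : ∀ {n} → DecidableEquality (Subset n)
_≟ˢ_ = ≡-dec _≟ᵇ_

allSubsets? : ∀ {n} {P : Pred (Subset n) 0ℓ} → Decidable P → Dec (∀ p → P p)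
allSubsets? P? =
  map′ (λ ¬∃¬ p → decidable-stable (P? p) λ ¬Pp → ¬∃¬ (p , ¬Pp))
       (λ ∀P (p , ¬Pp) → ¬Pp (∀P p))
       (¬? (anySubset? λ p → ¬? (P? p)))

isModule? : (H : Hypergraph) → Decidable (IsModule H)
isModule? H M = allSubsets? λ e →
  E? H e →-dec nonempty? (e ∩ M) →-dec nonempty? (e ─ M) →-dec
  any? λ m → (m ∈? M) ×-dec ((e ∩ M) ≟ˢ ⁅ m ⁆) ×-dec
             all? λ n → (n ∈? M) →-dec E? H ((e - m) ∪ ⁅ n ⁆)

isStrongModule? : (H : Hypergraph) → Decidable (IsStrongModule H)
isStrongModule? H M = isModule? H M ×-dec allSubsets? λ N →
  isModule? H N →-dec nonempty? (M ∩ N) →-dec (M ⊆? N ⊎-dec N ⊆? M)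

isProperStrongModule? : (H : Hypergraph) → Decidable (IsProperStrongModule H)
isProperStrongModule? H M = isStrongModule? H M ×-dec ¬? (M ≟ˢ ⊤)

isMaximalStrongModule? : (H : Hypergraph) → Decidable (IsMaximalStrongModule H)
isMaximalStrongModule? H M = isProperStrongModule? H M ×-dec allSubsets? λ N →
  isProperStrongModule? H N →-dec (M ⊆? N) →-dec (N ≟ˢ M)

subsets : ∀ n → List (Subset n)
subsets zero    = [] ∷ []
subsets (suc n) = map (outside ∷_) (subsets n) ++ map (inside ∷_) (subsets n)

∈-subsets : ∀ {n} (p : Subset n) → p List.∈ subsets n
∈-subsets []            = here refl
∈-subsets (outside ∷ p) = ∈-++⁺ˡ (∈-map⁺ _ (∈-subsets p))
∈-subsets (inside  ∷ p) = ∈-++⁺ʳ _ (∈-map⁺ _ (∈-subsets p))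

subsets-unique : ∀ n → Unique (subsets n)
subsets-unique zero    = [] ∷ []
subsets-unique (suc n) =
  Unique.++⁺ (Unique.map⁺ ∷-injectiveʳ (subsets-unique n))
             (Unique.map⁺ ∷-injectiveʳ (subsets-unique n))
             disjoint
  where
  disjoint : ∀ {p} → ¬ (p List.∈ map (outside ∷_) (subsets n) ×
                        p List.∈ map (inside ∷_) (subsets n))
  disjoint (p∈ , p∈′) with ∈-map⁻ _ p∈ | ∈-map⁻ _ p∈′
  ... | _ , _ , refl | _ , _ , ()

module _ {n} {P : Pred (Subset n) 0ℓ} (P? : Decidable P) where

  enumerate : List (Subset n)
  enumerate = filter P? (subsets n)

  ∈-enumerate : ∀ p → p List.∈ enumerate ⇔ P p
  ∈-enumerate p = mk⇔ (λ p∈ → proj₂ (∈-filter⁻ P? {xs = subsets n} p∈))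
                      (∈-filter⁺ P? (∈-subsets p))

  enumerate-unique : Unique enumerate
  enumerate-unique = Unique.filter⁺ P? (subsets-unique n)

-- The set Π(H), listed without repetition (see ∈-Π and Π-unique).
Π : (H : Hypergraph) → List (Subset (v H))
Π H = enumerate (isMaximalStrongModule? H)

∈-Π : (H : Hypergraph) (M : Subset (v H)) → M List.∈ Π H ⇔ IsMaximalStrongModule H M
∈-Π H = ∈-enumerate (isMaximalStrongModule? H)

Π-unique : (H : Hypergraph) → Unique (Π H)
Π-unique H = enumerate-unique (isMaximalStrongModule? H)

-- 𝓔 encodes the set {X ∈ P : X ∩ e ≠ ∅}, a set of blocks being given by
-- the set of their positions in P.
Meets : ∀ {n} (P : List (Subset n)) → Subset n → Subset (length P) → Set
Meets P e 𝓔 = ∀ i → i ∈ 𝓔 ⇔ Nonempty (lookup P i ∩ e)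

meets? : ∀ {n} (P : List (Subset n)) e → Decidable (Meets P e)
meets? P e 𝓔 = all? λ i →
  map′ (uncurry mk⇔) (λ eq → Equivalence.to eq , Equivalence.from eq)
       ((i ∈? 𝓔 →-dec nonempty? (lookup P i ∩ e)) ×-dec
        (nonempty? (lookup P i ∩ e) →-dec i ∈? 𝓔))

-- The quotient H/P, whose vertex set P is represented by the positions in a
-- repetition-free list. The formula makes sense for every list P, but it is
-- meant for lists of the blocks of a partition into modules.
_/_ : (H : Hypergraph) → List (Subset (v H)) → Hypergraph
H / P = record
  { v    = length P
  ; E    = λ 𝓔 → 2 ≤ ∣ 𝓔 ∣ × ∃ λ e → E H e × Meets P e 𝓔
  ; E?   = λ 𝓔 → 2 ≤? ∣ 𝓔 ∣ ×-dec anySubset? λ e → E? H e ×-dec meets? P e 𝓔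
  ; size = proj₁
  }

{-# OPTIONS --safe #-}
module Submission where

-- If some proper nonempty D is crossed by no edge, then every connected
-- component is a strong module, so every edge lies in a block and the quotient
-- is empty. Complementing the edges of size 2 keeps the modules, so if this
-- happens after complementation, the quotient is a complete graph. Otherwise
-- every maximal proper module M is strong: an N overlapping M satisfies
-- M ∪ N = V, hence the complement of M is a module too, and two complementary
-- modules are joined either by no edge or exactly by all pairs. As a module of
-- the quotient pulls back to a module of H, the quotient is then prime.

open import Defs
open import Data.Empty using (⊥-elim)
open import Data.Fin using (Fin; zero; suc)
open import Data.Fin.Properties using () renaming (_≟_ to _≟ᶠ_)
open import Data.Fin.Subset
open import Data.Fin.Subset.Induction using (⊂-wellFounded; ⊃-wellFounded; Acc; acc)
open import Data.Fin.Subset.Properties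
open import Data.List using (List; _∷_; length)
import Data.List as List
import Data.List.Relation.Unary.All as All
open import Data.List.Relation.Unary.AllPairs using (_∷_)
open import Data.List.Relation.Unary.Any using (index)
open import Data.List.Relation.Unary.Any.Properties using (lookup-index)
open import Data.List.Relation.Unary.Unique.Propositional using (Unique)
open import Data.List.Membership.Propositional using () renaming (_∈_ to _∈ᴸ_)
open import Data.List.Membership.Propositional.Properties using (∈-lookup)
open import Data.Nat using (ℕ; suc; _≤_; z≤n; s≤s) renaming (_≟_ to _≟ⁿ_)
open import Data.Nat.Properties using (≤-trans; ≤-reflexive; <-irrefl)
open import Data.Product using (∃; ∃₂; _×_; _,_; proj₁; proj₂)
open import Data.Sum using (_⊎_; inj₁; inj₂; [_,_]′; swap)
open import Data.Vec using (_∷_; tabulate; here; there)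
open import Data.Vec.Properties using (lookup∘tabulate; lookup⇒[]=; []=⇒lookup)
open import Function using (_∘_; id; _⇔_; mk⇔; Equivalence)
open import Level using (0ℓ)
open import Relation.Binary.PropositionalEquality
open import Relation.Nullary
open import Relation.Nullary.Decidable using (decidable-stable; dec-true)
open import Relation.Unary using (Pred; Decidable)

-- Finite sets: differences, extremal subsets, comprehension

private variable
  n : ℕ
  p q e : Subset n
  x y z : Fin n

x∈p─q⇒x∉q : ∀ (p q : Subset n) → x ∈ p ─ q → x ∉ q
x∈p─q⇒x∉q (_ ∷ _) (_ ∷ _) () here
x∈p─q⇒x∉q (_ ∷ p) (_ ∷ q) (there x∈) (there x∈q) = x∈p─q⇒x∉q p q x∈ x∈q

x∈p-y⇒x∈p : x ∈ p - y → x ∈ p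
x∈p-y⇒x∈p = p─q⊆p _ _

x∈p-y⇒x≢y : x ∈ p - y → x ≢ y
x∈p-y⇒x≢y {p = p} {y} x∈ refl = x∈p─q⇒x∉q p ⁅ y ⁆ x∈ (x∈⁅x⁆ y)

⊈⇒∃ : p ⊈ q → ∃ λ x → x ∈ p × x ∉ q
⊈⇒∃ {p = p} {q} p⊈q with nonempty? (p ─ q)
... | yes (x , x∈) = x , p─q⊆p p q x∈ , x∈p─q⇒x∉q p q x∈
... | no empty = ⊥-elim (p⊈q λ {x} x∈p →
  decidable-stable (x ∈? q) λ x∉q → empty (x , x∈p∧x∉q⇒x∈p─q x∈p x∉q))

module _ {P : Pred (Subset n) 0ℓ} (P? : Decidable P) where

  minimal : ∀ p → P p → ∃ λ q → P q × q ⊆ p × (∀ r → P r → r ⊆ q → q ⊆ r)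
  minimal p = go p (⊂-wellFounded p)
    where
    go : ∀ p → Acc _⊂_ p → P p → ∃ λ q → P q × q ⊆ p × (∀ r → P r → r ⊆ q → q ⊆ r)
    go p (acc rec) Pp with anySubset? (λ r → P? r ×-dec r ⊂? p)
    ... | yes (r , Pr , r⊂p) =
      let q , Pq , q⊆r , min = go r (rec r⊂p) Pr in q , Pq , proj₁ r⊂p ∘ q⊆r , min
    ... | no ¬∃ = p , Pp , id , λ r Pr r⊆p {x} x∈p →
      decidable-stable (x ∈? r) λ x∉r → ¬∃ (r , Pr , r⊆p , x , x∈p , x∉r)

  maximal : ∀ p → P p → ∃ λ q → P q × p ⊆ q × (∀ r → P r → q ⊆ r → r ⊆ q)
  maximal p = go p (⊃-wellFounded p)
    where
    go : ∀ p → Acc _⊃_ p → P p → ∃ λ q → P q × p ⊆ q × (∀ r → P r → q ⊆ r → r ⊆ q)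
    go p (acc rec) Pp with anySubset? (λ r → P? r ×-dec p ⊂? r)
    ... | yes (r , Pr , p⊂r) =
      let q , Pq , r⊆q , max = go r (rec p⊂r) Pr in q , Pq , r⊆q ∘ proj₁ p⊂r , max
    ... | no ¬∃ = p , Pp , id , λ r Pr p⊆r {x} x∈r →
      decidable-stable (x ∈? p) λ x∉p → ¬∃ (r , Pr , p⊆r , x , x∈r , x∉p)

module _ {P : Pred (Fin n) 0ℓ} (P? : Decidable P) where

  comprehension : Subset n
  comprehension = tabulate λ x → does (P? x)

  ∈-comprehension⁺ : P x → x ∈ comprehension
  ∈-comprehension⁺ {x} Px =
    lookup⇒[]= x _ (trans (lookup∘tabulate _ x) (dec-true (P? x) Px))

  ∈-comprehension⁻ : x ∈ comprehension → P x
  ∈-comprehension⁻ {x} x∈ with P? x | trans (sym (lookup∘tabulate (does ∘ P?) x)) ([]=⇒lookup x∈)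
  ... | yes Px | _ = Px
  ... | no _ | ()

lookup-injective : ∀ {A : Set} {xs : List A} → Unique xs →
  ∀ {i j} → List.lookup xs i ≡ List.lookup xs j → i ≡ j
lookup-injective (_ ∷ _) {zero} {zero} _ = refl
lookup-injective {xs = _ ∷ xs} (x≢ ∷ _) {zero} {suc j} eq =
  contradiction eq (All.lookup x≢ (∈-lookup {xs = xs} j))
lookup-injective {xs = _ ∷ xs} (x≢ ∷ _) {suc i} {zero} eq =
  contradiction (sym eq) (All.lookup x≢ (∈-lookup {xs = xs} i))
lookup-injective (_ ∷ u) {suc i} {suc j} eq = cong suc (lookup-injective u eq)

-- Two-element sets and cardinalities

pair : Fin n → Fin n → Subset n
pair x y = ⁅ x ⁆ ∪ ⁅ y ⁆

∈-pairˡ : x ∈ pair x y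
∈-pairˡ {x = x} {y} = p⊆p∪q ⁅ y ⁆ (x∈⁅x⁆ x)

∈-pairʳ : y ∈ pair x y
∈-pairʳ {y = y} {x} = q⊆p∪q ⁅ x ⁆ ⁅ y ⁆ (x∈⁅x⁆ y)

∈-pair⁻ : z ∈ pair x y → z ≡ x ⊎ z ≡ y
∈-pair⁻ {x = x} {y} z∈ with x∈p∪q⁻ ⁅ x ⁆ ⁅ y ⁆ z∈
... | inj₁ z∈x = inj₁ (x∈⁅y⁆⇒x≡y x z∈x)
... | inj₂ z∈y = inj₂ (x∈⁅y⁆⇒x≡y y z∈y)

≡-pair : x ∈ p → y ∈ p → (∀ {z} → z ∈ p → z ≡ x ⊎ z ≡ y) → p ≡ pair x y
≡-pair {x = x} {p} {y} x∈p y∈p p⊆ = ⊆-antisym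
  (λ z∈p → [ (λ { refl → ∈-pairˡ }) , (λ { refl → ∈-pairʳ }) ]′ (p⊆ z∈p))
  (λ z∈ → [ (λ { refl → x∈p }) , (λ { refl → y∈p }) ]′ (∈-pair⁻ z∈))

size-remove : x ∈ p → suc ∣ p - x ∣ ≡ ∣ p ∣
size-remove (here {xs = p}) = cong (suc ∘ ∣_∣) (p─⊥≡p p)
size-remove {p = inside ∷ _} (there x∈p) = cong suc (size-remove x∈p)
size-remove {p = outside ∷ _} (there x∈p) = size-remove x∈p

size-insert : ∀ (p : Subset n) x → x ∉ p → ∣ p ∪ ⁅ x ⁆ ∣ ≡ suc ∣ p ∣
size-insert (inside ∷ p) zero x∉p = contradiction here x∉p
size-insert (outside ∷ p) zero x∉p = cong (suc ∘ ∣_∣) (∪-identityʳ p)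
size-insert (inside ∷ p) (suc x) x∉p = cong suc (size-insert p x (x∉p ∘ there))
size-insert (outside ∷ p) (suc x) x∉p = size-insert p x (x∉p ∘ there)

size-pair : x ≢ y → ∣ pair x y ∣ ≡ 2
size-pair {x = x} {y} x≢y = trans
  (size-insert ⁅ x ⁆ y (x≢y ∘ sym ∘ x∈⁅y⁆⇒x≡y x)) (cong suc (∣⁅x⁆∣≡1 x))

size-positive : 1 ≤ ∣ p ∣ → Nonempty p
size-positive {n} {p} 1≤p with nonempty? p
... | yes ne = ne
... | no empty with refl ← Empty-unique empty with () ← subst (1 ≤_) (∣⊥∣≡0 n) 1≤p

2≤size : x ∈ p → y ∈ p → x ≢ y → 2 ≤ ∣ p ∣
2≤size x∈p y∈p x≢y = ≤-trans
  (s≤s (≤-trans (s≤s z≤n) (x∈p⇒∣p-x∣<∣p∣ (x∈p∧x≢y⇒x∈p-y y∈p (x≢y ∘ sym)))))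
  (x∈p⇒∣p-x∣<∣p∣ x∈p)

3≤size : x ∈ p → y ∈ p → z ∈ p → x ≢ y → x ≢ z → y ≢ z → 3 ≤ ∣ p ∣
3≤size x∈p y∈p z∈p x≢y x≢z y≢z = ≤-trans
  (s≤s (2≤size (x∈p∧x≢y⇒x∈p-y y∈p (x≢y ∘ sym)) (x∈p∧x≢y⇒x∈p-y z∈p (x≢z ∘ sym)) y≢z))
  (x∈p⇒∣p-x∣<∣p∣ x∈p)

2≤size⇒distinct : 2 ≤ ∣ p ∣ → ∃₂ λ x y → x ≢ y × x ∈ p × y ∈ p
2≤size⇒distinct {p = p} 2≤p with size-positive (≤-trans (s≤s z≤n) 2≤p)
... | x , x∈p with subst (2 ≤_) (sym (size-remove x∈p)) 2≤p
... | s≤s 1≤ with size-positive {p = p - x} 1≤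
... | y , y∈ = x , y , x∈p-y⇒x≢y y∈ ∘ sym , x∈p , x∈p-y⇒x∈p y∈

size≡2⇒pair : ∣ p ∣ ≡ 2 → x ∈ p → y ∈ p → x ≢ y → p ≡ pair x y
size≡2⇒pair {p = p} {x} {y} p≡2 x∈p y∈p x≢y = ≡-pair x∈p y∈p inPair
  where
  inPair : ∀ {z} → z ∈ p → z ≡ x ⊎ z ≡ y
  inPair {z} z∈p with z ≟ᶠ x | z ≟ᶠ y
  ... | yes z≡x | _ = inj₁ z≡x
  ... | no _ | yes z≡y = inj₂ z≡y
  ... | no z≢x | no z≢y = contradiction
    (subst (3 ≤_) p≡2 (3≤size x∈p y∈p z∈p x≢y (z≢x ∘ sym) (z≢y ∘ sym))) λ { (s≤s (s≤s ())) }

-- Exchanging one vertex of an edge for another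

replace : Subset n → Fin n → Fin n → Subset n
replace e x y = (e - x) ∪ ⁅ y ⁆

∈-replace-old : z ∈ e → z ≢ x → z ∈ replace e x y
∈-replace-old z∈e z≢x = p⊆p∪q _ (x∈p∧x≢y⇒x∈p-y z∈e z≢x)

∈-replace-new : y ∈ replace e x y
∈-replace-new {y = y} {e = e} {x} = q⊆p∪q (e - x) ⁅ y ⁆ (x∈⁅x⁆ y)

∈-replace⁻ : z ∈ replace e x y → (z ∈ e × z ≢ x) ⊎ z ≡ y
∈-replace⁻ {e = e} {x} {y} z∈ with x∈p∪q⁻ (e - x) ⁅ y ⁆ z∈
... | inj₁ z∈e-x = inj₁ (x∈p-y⇒x∈p z∈e-x , x∈p-y⇒x≢y z∈e-x)
... | inj₂ z∈y = inj₂ (x∈⁅y⁆⇒x≡y y z∈y)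

replace-self : x ∈ e → replace e x x ≡ e
replace-self {x = x} {e = e} x∈e = ⊆-antisym
  (λ z∈ → [ proj₁ , (λ { refl → x∈e }) ]′ (∈-replace⁻ z∈)) ⊇
  where
  ⊇ : e ⊆ replace e x x
  ⊇ {z} z∈e with z ≟ᶠ x
  ... | yes refl = ∈-replace-new
  ... | no z≢x = ∈-replace-old z∈e z≢x

-- The hypothesis `y ∈ e → y ≡ x` keeps the exchange from merging two vertices. When x and y lie in
-- a module crossed by the edge e, `unique` supplies it.
size-replace : x ∈ e → (y ∈ e → y ≡ x) → ∣ replace e x y ∣ ≡ ∣ e ∣
size-replace {x = x} {e = e} {y} x∈e y∈e⇒y≡x = trans
  (size-insert (e - x) y λ y∈ → x∈p-y⇒x≢y y∈ (y∈e⇒y≡x (x∈p-y⇒x∈p y∈)))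
  (size-remove x∈e)

replace-trans : ∀ {w} → (y ∈ e → y ≡ x) → replace (replace e x y) y w ≡ replace e x w
replace-trans {y = y} {e = e} {x} {w} y∈e⇒y≡x = ⊆-antisym ⊆′ ⊇′
  where
  ⊆′ : replace (replace e x y) y w ⊆ replace e x w
  ⊆′ z∈ with ∈-replace⁻ {e = replace e x y} z∈
  ... | inj₂ refl = ∈-replace-new
  ... | inj₁ (z∈′ , z≢y) with ∈-replace⁻ z∈′
  ... | inj₁ (z∈e , z≢x) = ∈-replace-old z∈e z≢x
  ... | inj₂ z≡y = contradiction z≡y z≢y
  ⊇′ : replace e x w ⊆ replace (replace e x y) y w
  ⊇′ z∈ with ∈-replace⁻ z∈
  ... | inj₂ refl = ∈-replace-new {e = replace e x y}
  ... | inj₁ (z∈e , z≢x) =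
    ∈-replace-old {e = replace e x y} (∈-replace-old z∈e z≢x)
      λ { refl → z≢x (y∈e⇒y≡x z∈e) }

-- A detour through w makes room for the exchange of x for y.
replace-detour : ∀ {e : Subset n} {b w x y} →
  b ∈ e → b ≢ x → y ≢ w → (w ∈ e → w ≡ b) →
  replace (replace (replace e b w) x y) w b ≡ replace e x y
replace-detour {e = e} {b} {w} {x} {y} b∈e b≢x y≢w w∈e⇒w≡b = ⊆-antisym ⊆′ ⊇′
  where
  e₁ = replace e b w
  e₂ = replace e₁ x y
  ⊆′ : replace e₂ w b ⊆ replace e x y
  ⊆′ z∈ with ∈-replace⁻ {e = e₂} z∈
  ... | inj₂ refl = ∈-replace-old b∈e b≢x
  ... | inj₁ (z∈₂ , z≢w) with ∈-replace⁻ {e = e₁} z∈₂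
  ... | inj₂ refl = ∈-replace-new {e = e}
  ... | inj₁ (z∈₁ , z≢x) with ∈-replace⁻ {e = e} z∈₁
  ... | inj₁ (z∈e , _) = ∈-replace-old z∈e z≢x
  ... | inj₂ z≡w = contradiction z≡w z≢w
  ⊇′ : replace e x y ⊆ replace e₂ w b
  ⊇′ {z} z∈ with ∈-replace⁻ {e = e} z∈
  ... | inj₂ refl = ∈-replace-old {e = e₂} (∈-replace-new {e = e₁}) y≢w
  ... | inj₁ (z∈e , z≢x) with z ≟ᶠ b
  ... | yes refl = ∈-replace-new {e = e₂}
  ... | no z≢b = ∈-replace-old {e = e₂}
    (∈-replace-old {e = e₁} (∈-replace-old z∈e z≢b) z≢x) λ { refl → z≢b (w∈e⇒w≡b z∈e) }

-- Modules in elementwise form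

-- This is `IsModule` without the existential: any vertex x of e in M can serve as m, since there is
-- only one, and w witnesses that e leaves M.
record Module (H : Hypergraph) (M : Subset (v H)) : Set where
  field
    unique : ∀ {e x y w} → E H e → x ∈ e → x ∈ M → w ∈ e → w ∉ M → y ∈ e → y ∈ M → y ≡ x
    exchange : ∀ {e x y w} → E H e → x ∈ e → x ∈ M → w ∈ e → w ∉ M → y ∈ M →
               E H (replace e x y)

open Module

module _ (H : Hypergraph) where

  fromIsModule : ∀ {M} → IsModule H M → Module H M
  fromIsModule {M} isM = record
    { unique = λ Ee x∈e x∈M w∈e w∉M y∈e y∈M →
        let m , _ , eq , _ = crossing Ee x∈e x∈M w∈e w∉M in
        trans (only m eq y∈e y∈M) (sym (only m eq x∈e x∈M))
    ; exchange = λ {e} {x} {y} Ee x∈e x∈M w∈e w∉M y∈M →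
        let m , _ , eq , ex = crossing Ee x∈e x∈M w∈e w∉M in
        subst (λ m → E H (replace e m y)) (sym (only m eq x∈e x∈M)) (ex y y∈M)
    }
    where
    crossing : ∀ {e x w} → E H e → x ∈ e → x ∈ M → w ∈ e → w ∉ M →
      ∃ λ m → m ∈ M × e ∩ M ≡ ⁅ m ⁆ × (∀ n → n ∈ M → E H (replace e m n))
    crossing Ee x∈e x∈M w∈e w∉M =
      isM _ Ee (_ , x∈p∩q⁺ (x∈e , x∈M)) (_ , x∈p∧x∉q⇒x∈p─q w∈e w∉M)
    only : ∀ {e x} m → e ∩ M ≡ ⁅ m ⁆ → x ∈ e → x ∈ M → x ≡ m
    only m eq x∈e x∈M = x∈⁅y⁆⇒x≡y m (subst (_ ∈_) eq (x∈p∩q⁺ (x∈e , x∈M)))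

  toIsModule : ∀ {M} → Module H M → IsModule H M
  toIsModule {M} mod e Ee (m , m∈) (w , w∈) =
    let m∈e , m∈M = x∈p∩q⁻ e M m∈
        w∈e = p─q⊆p e M w∈
        w∉M = x∈p─q⇒x∉q e M w∈
    in m , m∈M
     , ⊆-antisym
         (λ y∈ → let y∈e , y∈M = x∈p∩q⁻ e M y∈ in
           subst (_∈ ⁅ m ⁆) (sym (unique mod Ee m∈e m∈M w∈e w∉M y∈e y∈M)) (x∈⁅x⁆ m))
         (λ y∈ → subst (_∈ e ∩ M) (sym (x∈⁅y⁆⇒x≡y m y∈)) m∈)
     , λ n n∈M → exchange mod Ee m∈e m∈M w∈e w∉M n∈M

  -- Unions and complements of overlapping modules

  module _ {M N : Subset (v H)} (M-mod : Module H M) (N-mod : Module H N)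
           {z} (z∈M : z ∈ M) (z∈N : z ∈ N) where

    private
      -- If y were outside M, exchanging x for the common vertex z would give an edge that contains
      -- both z and y from N and still leaves N at c. Then y is z, which lies in M.
      second∈first : ∀ {e x y c} → E H e → x ∈ e → x ∈ M → y ∈ e → y ∈ N →
        c ∈ e → c ∉ M → c ∉ N → y ∈ M
      second∈first {e} {x} {y} Ee x∈e x∈M y∈e y∈N c∈e c∉M c∉N =
        decidable-stable (y ∈? M) λ y∉M → y∉M (subst (_∈ M) (sym (y≡z y∉M)) z∈M)
        where
        y≡z : y ∉ M → y ≡ z
        y≡z y∉M = unique N-mod (exchange M-mod Ee x∈e x∈M c∈e c∉M z∈M)
          (∈-replace-new {e = e}) z∈N
          (∈-replace-old c∈e λ { refl → c∉M x∈M }) c∉N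
          (∈-replace-old y∈e λ { refl → y∉M x∈M }) y∈N

    unique-∪ : ∀ {e x y c} → E H e → x ∈ e → x ∈ M → c ∈ e → c ∉ M → c ∉ N →
      y ∈ e → y ∈ M ⊎ y ∈ N → y ≡ x
    unique-∪ Ee x∈e x∈M c∈e c∉M c∉N y∈e (inj₁ y∈M) = unique M-mod Ee x∈e x∈M c∈e c∉M y∈e y∈M
    unique-∪ Ee x∈e x∈M c∈e c∉M c∉N y∈e (inj₂ y∈N) =
      unique M-mod Ee x∈e x∈M c∈e c∉M y∈e (second∈first Ee x∈e x∈M y∈e y∈N c∈e c∉M c∉N)

    exchange-∪ : ∀ {e x y c} → E H e → x ∈ e → x ∈ M → c ∈ e → c ∉ M → c ∉ N →
      y ∈ M ⊎ y ∈ N → E H (replace e x y)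
    exchange-∪ Ee x∈e x∈M c∈e c∉M c∉N (inj₁ y∈M) = exchange M-mod Ee x∈e x∈M c∈e c∉M y∈M
    -- The exchange passes through the common vertex: x for z inside M, then z for y inside N.
    exchange-∪ {e} Ee x∈e x∈M c∈e c∉M c∉N (inj₂ y∈N) = subst (E H)
      (replace-trans λ z∈e → unique M-mod Ee x∈e x∈M c∈e c∉M z∈e z∈M)
      (exchange N-mod (exchange M-mod Ee x∈e x∈M c∈e c∉M z∈M)
        (∈-replace-new {e = e}) z∈N
        (∈-replace-old c∈e λ { refl → c∉M x∈M }) c∉N y∈N)

  union-module : ∀ {M N} → Module H M → Module H N → Nonempty (M ∩ N) → Module H (M ∪ N)
  union-module {M} {N} M-mod N-mod (z , z∈) = record
    { unique = λ Ee x∈e x∈ w∈e w∉ y∈e y∈ →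
        [ (λ x∈M → unique-∪ M-mod N-mod z∈M z∈N Ee x∈e x∈M w∈e (∉M w∉) (∉N w∉) y∈e (split y∈))
        , (λ x∈N → unique-∪ N-mod M-mod z∈N z∈M Ee x∈e x∈N w∈e (∉N w∉) (∉M w∉) y∈e (swap (split y∈)))
        ]′ (split x∈)
    ; exchange = λ Ee x∈e x∈ w∈e w∉ y∈ →
        [ (λ x∈M → exchange-∪ M-mod N-mod z∈M z∈N Ee x∈e x∈M w∈e (∉M w∉) (∉N w∉) (split y∈))
        , (λ x∈N → exchange-∪ N-mod M-mod z∈N z∈M Ee x∈e x∈N w∈e (∉N w∉) (∉M w∉) (swap (split y∈)))
        ]′ (split x∈)
    }
    where
    z∈M = proj₁ (x∈p∩q⁻ M N z∈)
    z∈N = proj₂ (x∈p∩q⁻ M N z∈)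
    split : ∀ {x} → x ∈ M ∪ N → x ∈ M ⊎ x ∈ N
    split = x∈p∪q⁻ M N
    ∉M : ∀ {x} → x ∉ M ∪ N → x ∉ M
    ∉M x∉ = x∉ ∘ p⊆p∪q N
    ∉N : ∀ {x} → x ∉ M ∪ N → x ∉ N
    ∉N x∉ = x∉ ∘ q⊆p∪q M N

  -- An edge crossing M is first moved off N by exchanging its vertex in M for w.
  complement-module : ∀ {M N w} → Module H M → Module H N →
    ∁ M ⊆ N → w ∈ M → w ∉ N → Module H (∁ M)
  complement-module {M} {N} {w} M-mod N-mod ∁M⊆N w∈M w∉N = record
    { unique = λ {e} {x} {y} {b} Ee x∈e x∈∁ b∈e b∉∁ y∈e y∈∁ →
        unique N-mod (moved Ee x∈e x∈∁ b∈e b∉∁)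
          (∈-replace-old x∈e (λ { refl → b∉∁ x∈∁ })) (∁M⊆N x∈∁)
          (∈-replace-new {e = e}) w∉N
          (∈-replace-old y∈e λ { refl → b∉∁ y∈∁ }) (∁M⊆N y∈∁)
    ; exchange = λ {e} {x} {y} {b} Ee x∈e x∈∁ b∈e b∉∁ y∈∁ →
        let x∉M = x∈∁p⇒x∉p x∈∁
            y∉M = x∈∁p⇒x∉p y∈∁
            b∈M = x∉∁p⇒x∈p b∉∁
            e₁ = replace e b w
        in subst (E H)
          (replace-detour b∈e (λ { refl → b∉∁ x∈∁ }) (λ { refl → y∉M w∈M })
            λ w∈e → unique M-mod Ee b∈e b∈M x∈e x∉M w∈e w∈M)
          (exchange M-mod
            (exchange N-mod (moved Ee x∈e x∈∁ b∈e b∉∁)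
              (∈-replace-old x∈e (λ { refl → b∉∁ x∈∁ })) (∁M⊆N x∈∁)
              (∈-replace-new {e = e}) w∉N (∁M⊆N y∈∁))
            (∈-replace-old {e = e₁} (∈-replace-new {e = e}) λ { refl → x∉M w∈M }) w∈M
            (∈-replace-new {e = e₁}) y∉M b∈M)
    }
    where
    moved : ∀ {e x b} → E H e → x ∈ e → x ∈ ∁ M → b ∈ e → b ∉ ∁ M → E H (replace e b w)
    moved Ee x∈e x∈∁ b∈e b∉∁ =
      exchange M-mod Ee b∈e (x∉∁p⇒x∈p b∉∁) x∈e (x∈∁p⇒x∉p x∈∁) w∈M

-- Complementing the edges of size 2

-- This keeps the modules, and turns a complete graph into an empty hypergraph.
toggle : Hypergraph → Hypergraph
toggle H = record
  { v = v H
  ; E = λ e → (∣ e ∣ ≡ 2 × ¬ E H e) ⊎ (∣ e ∣ ≢ 2 × E H e)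
  ; E? = λ e → ((∣ e ∣ ≟ⁿ 2) ×-dec ¬? (E? H e)) ⊎-dec (¬? (∣ e ∣ ≟ⁿ 2) ×-dec E? H e)
  ; size = [ ≤-reflexive ∘ sym ∘ proj₁ , size H ∘ proj₂ ]′
  }

module _ (H : Hypergraph) where

  -- A pair crossing M has only one vertex in M, so uniqueness is automatic for the new edges.
  -- Exchanges preserve size and are reversible, so they map edges to edges and missing pairs to
  -- missing pairs.
  toggle-module : ∀ {M} → Module H M → Module (toggle H) M
  toggle-module {M} mod = record { unique = unique′ ; exchange = exchange′ }
    where
    unique′ : ∀ {e x y w} → E (toggle H) e → x ∈ e → x ∈ M → w ∈ e → w ∉ M → y ∈ e → y ∈ M → y ≡ x
    unique′ (inj₂ (_ , Ee)) = unique mod Ee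
    unique′ {x = x} {y} (inj₁ (e≡2 , _)) x∈e x∈M w∈e w∉M y∈e y∈M =
      decidable-stable (y ≟ᶠ x) λ y≢x → contradiction
        (subst (3 ≤_) e≡2 (3≤size y∈e x∈e w∈e y≢x (λ { refl → w∉M y∈M }) (λ { refl → w∉M x∈M })))
        λ { (s≤s (s≤s ())) }
    exchange′ : ∀ {e x y w} → E (toggle H) e → x ∈ e → x ∈ M → w ∈ e → w ∉ M → y ∈ M →
      E (toggle H) (replace e x y)
    exchange′ {e} {x} {y} E′e x∈e x∈M w∈e w∉M y∈M = result E′e
      where
      y≡x : y ∈ e → y ≡ x
      y≡x y∈e = unique′ E′e x∈e x∈M w∈e w∉M y∈e y∈M
      sizes : ∣ replace e x y ∣ ≡ ∣ e ∣
      sizes = size-replace x∈e y≡x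
      -- Exchanging y back for x restores e, so a missing pair cannot become an edge.
      back : E H (replace e x y) → E H e
      back Ee′ = subst (E H) (trans (replace-trans y≡x) (replace-self x∈e))
        (exchange mod Ee′ (∈-replace-new {e = e}) y∈M
          (∈-replace-old w∈e λ { refl → w∉M x∈M }) w∉M x∈M)
      result : E (toggle H) e → E (toggle H) (replace e x y)
      result (inj₁ (e≡2 , ¬Ee)) = inj₁ (trans sizes e≡2 , ¬Ee ∘ back)
      result (inj₂ (e≢2 , Ee)) = inj₂ (e≢2 ∘ trans (sym sizes) , exchange mod Ee x∈e x∈M w∈e w∉M y∈M)

module _ (H : Hypergraph) where

  -- Toggling twice restores the edges up to logical equivalence, by decidability of `E H`, so
  -- `toggle-module` also yields the converse.
  untoggle-module : ∀ {M} → Module (toggle H) M → Module H M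
  untoggle-module mod = record
    { unique = λ Ee → unique mod″ (into Ee)
    ; exchange = λ Ee x∈e x∈M w∈e w∉M y∈M → out (exchange mod″ (into Ee) x∈e x∈M w∈e w∉M y∈M)
    }
    where
    mod″ = toggle-module (toggle H) mod
    into : ∀ {e} → E H e → E (toggle (toggle H)) e
    into {e} Ee with ∣ e ∣ ≟ⁿ 2
    ... | yes e≡2 = inj₁ (e≡2 , [ (λ (_ , ¬Ee) → ¬Ee Ee) , (λ (e≢2 , _) → e≢2 e≡2) ]′)
    ... | no e≢2 = inj₂ (e≢2 , inj₂ (e≢2 , Ee))
    out : ∀ {e} → E (toggle (toggle H)) e → E H e
    out {e} (inj₁ (e≡2 , ¬E′e)) = decidable-stable (E? H e) λ ¬Ee → ¬E′e (inj₁ (e≡2 , ¬Ee))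
    out (inj₂ (e≢2 , inj₁ (e≡2 , _))) = contradiction e≡2 e≢2
    out (inj₂ (_ , inj₂ (_ , Ee))) = Ee

  -- Strength quantifies over all modules N, so both directions of the correspondence are needed:
  -- one for M, the other for N.
  untoggle-strong : ∀ {M} → IsStrongModule (toggle H) M → IsStrongModule H M
  untoggle-strong (mod , strong) =
    toIsModule H (untoggle-module (fromIsModule (toggle H) mod)) ,
    λ N N-mod → strong N (toIsModule (toggle H) (toggle-module H (fromIsModule H N-mod)))

-- Closed sets and connected components

-- Closed sets are the unions of connected components.
IsClosed : (H : Hypergraph) → Subset (v H) → Set
IsClosed H D = ∀ e → E H e → Nonempty (e ∩ D) → e ⊆ D

isClosed? : (H : Hypergraph) → Decidable (IsClosed H)
isClosed? H D = allSubsets? λ e → E? H e →-dec nonempty? (e ∩ D) →-dec e ⊆? D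

-- Such a D certifies that H is disconnected.
IsSplit : (H : Hypergraph) → Subset (v H) → Set
IsSplit H D = IsClosed H D × Nonempty D × Nonempty (∁ D)

isSplit? : (H : Hypergraph) → Decidable (IsSplit H)
isSplit? H D = isClosed? H D ×-dec nonempty? D ×-dec nonempty? (∁ D)

module _ (H : Hypergraph) where

  closed-∁ : ∀ {D} → IsClosed H D → IsClosed H (∁ D)
  closed-∁ {D} closed e Ee (x , x∈) {y} y∈e =
    let x∈e , x∈∁ = x∈p∩q⁻ e (∁ D) x∈ in
    x∉p⇒x∈∁p λ y∈D → x∈∁p⇒x∉p x∈∁ (closed e Ee (y , x∈p∩q⁺ (y∈e , y∈D)) x∈e)

  closed⇒module : ∀ {D} → IsClosed H D → Module H D
  closed⇒module {D} closed = record
    { unique = λ Ee x∈e x∈D w∈e w∉D → contradiction (step Ee x∈e x∈D w∈e) w∉D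
    ; exchange = λ Ee x∈e x∈D w∈e w∉D → contradiction (step Ee x∈e x∈D w∈e) w∉D
    }
    where
    step : ∀ {e x w} → E H e → x ∈ e → x ∈ D → w ∈ e → w ∈ D
    step Ee x∈e x∈D = closed _ Ee (_ , x∈p∩q⁺ (x∈e , x∈D))

  -- C is a minimal closed set around x. If it were all of V, minimality would put it inside D or
  -- `∁ D`, whichever contains x. Strength comes from `C⊆N`.
  component : ∀ {D} → IsSplit H D → ∀ x →
    ∃ λ C → x ∈ C × IsClosed H C × IsProperStrongModule H C
  component {D} (D-closed , (d , d∈D) , (u , u∈∁D)) x
    with minimal (λ C → (x ∈? C) ×-dec isClosed? H C) ⊤ (∈⊤ , λ _ _ _ _ → ∈⊤)
  ... | C , (x∈C , C-closed) , _ , C-min =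
    C , x∈C , C-closed , (toIsModule H (closed⇒module C-closed) , strong) , proper
    where
    proper : C ≢ ⊤
    proper refl with x ∈? D
    ... | yes x∈D = x∈∁p⇒x∉p u∈∁D (C-min D (x∈D , D-closed) ⊆⊤ ∈⊤)
    ... | no x∉D = x∈∁p⇒x∉p (C-min (∁ D) (x∉p⇒x∈∁p x∉D , closed-∁ D-closed) ⊆⊤ ∈⊤) d∈D

    module _ {N z y} (N-mod : Module H N) (z∈N : z ∈ N) (z∉C : z ∉ C) (y∈C : y ∈ C) (y∈N : y ∈ N) where

      inC : ∀ {e a b} → E H e → a ∈ e → a ∈ C → b ∈ e → b ∈ C
      inC Ee a∈e a∈C = C-closed _ Ee (_ , x∈p∩q⁺ (a∈e , a∈C))

      -- Exchanging a for z would give an edge crossing C.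
      stays : ∀ {e a b} → E H e → a ∈ e → a ∈ C → a ∈ N → b ∈ e → b ∈ N
      stays {e} {a} {b} Ee a∈e a∈C a∈N b∈e = decidable-stable (b ∈? N) λ b∉N → z∉C
        (inC (exchange N-mod Ee a∈e a∈N b∈e b∉N z∈N)
          (∈-replace-old b∈e λ { refl → b∉N a∈N }) (inC Ee a∈e a∈C b∈e)
          (∈-replace-new {e = e}))

      -- By `stays`, no edge meets both `C ∩ N` and `C ∩ ∁ N`, so these are closed. Minimality makes
      -- C equal to the one containing x, and y rules out the second.
      C⊆N : C ⊆ N
      C⊆N with x ∈? N
      ... | yes x∈N = p∩q⊆q C N ∘ C-min (C ∩ N) (x∈p∩q⁺ (x∈C , x∈N) , ∩-closed) (p∩q⊆p C N)
        where
        ∩-closed : IsClosed H (C ∩ N)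
        ∩-closed e Ee (a , a∈) b∈e =
          let a∈e , a∈C∩N = x∈p∩q⁻ e (C ∩ N) a∈
              a∈C , a∈N = x∈p∩q⁻ C N a∈C∩N
          in x∈p∩q⁺ (inC Ee a∈e a∈C b∈e , stays Ee a∈e a∈C a∈N b∈e)
      ... | no x∉N = contradiction y∈N (x∈∁p⇒x∉p (p∩q⊆q C (∁ N)
              (C-min (C ∩ ∁ N) (x∈p∩q⁺ (x∈C , x∉p⇒x∈∁p x∉N) , ─-closed) (p∩q⊆p C (∁ N)) y∈C)))
        where
        ─-closed : IsClosed H (C ∩ ∁ N)
        ─-closed e Ee (a , a∈) b∈e =
          let a∈e , a∈C∩∁N = x∈p∩q⁻ e (C ∩ ∁ N) a∈
              a∈C , a∈∁N = x∈p∩q⁻ C (∁ N) a∈C∩∁N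
              b∈C = inC Ee a∈e a∈C b∈e
          in x∈p∩q⁺ (b∈C , x∉p⇒x∈∁p λ b∈N → x∈∁p⇒x∉p a∈∁N (stays Ee b∈e b∈C b∈N a∈e))

    strong : ∀ N → IsModule H N → Nonempty (C ∩ N) → C ⊆ N ⊎ N ⊆ C
    strong N N-mod (y , y∈) with N ⊆? C
    ... | yes N⊆C = inj₂ N⊆C
    ... | no N⊈C =
      let z , z∈N , z∉C = ⊈⇒∃ N⊈C
          y∈C , y∈N = x∈p∩q⁻ C N y∈
      in inj₁ (C⊆N (fromIsModule H N-mod) z∈N z∉C y∈C y∈N)

  -- Complementary modules

  module _ {M} (M-mod : Module H M) (∁M-mod : Module H (∁ M)) where

    -- Uniqueness on each side leaves one vertex in M and one in `∁ M`.
    crossing≡pair : ∀ {e x y} → E H e → x ∈ e → x ∈ M → y ∈ e → y ∉ M → e ≡ pair x y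
    crossing≡pair {e} {x} {y} Ee x∈e x∈M y∈e y∉M = ≡-pair x∈e y∈e inPair
      where
      inPair : ∀ {z} → z ∈ e → z ≡ x ⊎ z ≡ y
      inPair {z} z∈e with z ∈? M
      ... | yes z∈M = inj₁ (unique M-mod Ee x∈e x∈M y∈e y∉M z∈e z∈M)
      ... | no z∉M = inj₂ (unique ∁M-mod Ee y∈e (x∉p⇒x∈∁p y∉M) x∈e
                             (λ x∈∁ → x∈∁p⇒x∉p x∈∁ x∈M) z∈e (x∉p⇒x∈∁p z∉M))

    -- The two ends of a crossing edge can be moved independently, m to x within M and w to y within
    -- `∁ M`.
    crossing⇒all-pairs : ∀ {e m w x y} → E H e → m ∈ e → m ∈ M → w ∈ e → w ∉ M →
      x ∈ M → y ∉ M → E H (pair x y)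
    crossing⇒all-pairs {e} {m} {w} {x} {y} Ee m∈e m∈M w∈e w∉M x∈M y∉M =
      subst (E H) (crossing≡pair Ee₂ x∈e₂ x∈M (∈-replace-new {e = e₁}) y∉M) Ee₂
      where
      e₁ = replace e m x
      x∈e₂ : x ∈ replace e₁ w y
      x∈e₂ = ∈-replace-old (∈-replace-new {e = e}) λ { refl → w∉M x∈M }
      Ee₂ : E H (replace e₁ w y)
      Ee₂ = exchange ∁M-mod (exchange M-mod Ee m∈e m∈M w∈e w∉M x∈M)
        (∈-replace-old w∈e λ { refl → w∉M m∈M }) (x∉p⇒x∈∁p w∉M)
        (∈-replace-new {e = e}) (λ x∈∁ → x∈∁p⇒x∉p x∈∁ x∈M) (x∉p⇒x∈∁p y∉M)

    complementary⇒closed : IsClosed H M ⊎ IsClosed (toggle H) M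
    complementary⇒closed with isClosed? H M
    ... | yes closed = inj₁ closed
    ... | no ¬closed = inj₂ toggle-closed
      where
      toggle-closed : IsClosed (toggle H) M
      toggle-closed f (inj₂ (f≢2 , Ef)) (x , x∈) {y} y∈f =
        let x∈f , x∈M = x∈p∩q⁻ f M x∈ in
        decidable-stable (y ∈? M) λ y∉M → f≢2
          (trans (cong ∣_∣ (crossing≡pair Ef x∈f x∈M y∈f y∉M)) (size-pair {x = x} {y} λ { refl → y∉M x∈M }))
      -- Here f is a missing pair. If it crossed M, a single crossing edge of H would force f to be
      -- an edge, so M would be closed in H.
      toggle-closed f (inj₁ (f≡2 , ¬Ef)) (x , x∈) {y} y∈f =
        let x∈f , x∈M = x∈p∩q⁻ f M x∈ in
        decidable-stable (y ∈? M) λ y∉M → ¬closed λ e Ee (m , m∈) {w} w∈e →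
          let m∈e , m∈M = x∈p∩q⁻ e M m∈ in
          decidable-stable (w ∈? M) λ w∉M → ¬Ef (subst (E H)
            (sym (size≡2⇒pair f≡2 x∈f y∈f λ { refl → y∉M x∈M }))
            (crossing⇒all-pairs Ee m∈e m∈M w∈e w∉M x∈M y∉M))

-- Quotient by a partition into modules

module _ (H : Hypergraph) (P : List (Subset (v H)))
         (β : Fin (v H) → Fin (length P))
         (∈-block : ∀ x → x ∈ List.lookup P (β x))
         (β-unique : ∀ {x i} → x ∈ List.lookup P i → β x ≡ i)
         (block-module : ∀ i → Module H (List.lookup P i)) where

  private
    ∈-block′ : ∀ {x i} → β x ≡ i → x ∈ List.lookup P i
    ∈-block′ {x} refl = ∈-block x

  -- Whichever block x and y share, one of a and b lies outside it, so e crosses that block and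
  -- `unique` applies.
  crossing-injective : ∀ {e a b} → E H e → a ∈ e → b ∈ e → β a ≢ β b →
    ∀ {x y} → x ∈ e → y ∈ e → β x ≡ β y → x ≡ y
  crossing-injective Ee a∈e b∈e βa≢βb {x} {y} x∈e y∈e βx≡βy with β _ ≟ᶠ β y
  ... | no βa≢βy = unique (block-module (β y)) Ee y∈e (∈-block y)
                     a∈e (βa≢βy ∘ β-unique) x∈e (∈-block′ βx≡βy)
  ... | yes βa≡βy = unique (block-module (β y)) Ee y∈e (∈-block y)
                      b∈e (λ b∈ → βa≢βb (trans βa≡βy (sym (β-unique b∈)))) x∈e (∈-block′ βx≡βy)

  -- A crossing edge picks one vertex from each block it meets. Exchanges inside the blocks turn it
  -- into any other such choice g from the same blocks.
  transversal-edge : ∀ {f g a b} → E H f → a ∈ f → b ∈ f → β a ≢ β b →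
    (∀ {x y} → x ∈ g → y ∈ g → β x ≡ β y → x ≡ y) →
    (∀ {x} → x ∈ f → ∃ λ y → y ∈ g × β x ≡ β y) →
    (∀ {y} → y ∈ g → ∃ λ x → x ∈ f × β x ≡ β y) →
    E H g
  transversal-edge {f} {g} Ef₀ a₀∈f b₀∈f βa≢βb₀ g-inj f→g₀ g→f₀ =
    go f (⊂-wellFounded (g ─ f)) Ef₀ a₀∈f b₀∈f βa≢βb₀ f→g₀ g→f₀
    where
    -- The vertices of g are brought into f one at a time, each replacing the
    -- vertex of f in the same block.
    go : ∀ f → Acc _⊂_ (g ─ f) → ∀ {a b} → E H f → a ∈ f → b ∈ f → β a ≢ β b →
      (∀ {x} → x ∈ f → ∃ λ y → y ∈ g × β x ≡ β y) →
      (∀ {y} → y ∈ g → ∃ λ x → x ∈ f × β x ≡ β y) →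
      E H g
    go f (acc rec) {a} {b} Ef a∈f b∈f βa≢βb f→g g→f with nonempty? (g ─ f)
    ... | no empty = subst (E H) (⊆-antisym f⊆g g⊆f) Ef
      where
      g⊆f : g ⊆ f
      g⊆f {y} y∈g = decidable-stable (y ∈? f) λ y∉f → empty (y , x∈p∧x∉q⇒x∈p─q y∈g y∉f)
      f⊆g : f ⊆ g
      f⊆g x∈f =
        let y , y∈g , βx≡βy = f→g x∈f in
        subst (_∈ g) (sym (crossing-injective Ef a∈f b∈f βa≢βb x∈f (g⊆f y∈g) βx≡βy)) y∈g
    ... | yes (y , y∈g─f) =
      let w , w∈f , βw≢βs = outsider
          w≢s = λ w≡s → βw≢βs (cong β w≡s)
      in go f′ (rec measure)
           (exchange (block-module (β s)) Ef s∈f (∈-block s) w∈f (βw≢βs ∘ β-unique) (∈-block′ (sym βs≡βy)))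
           (∈-replace-old w∈f w≢s) (∈-replace-new {e = f}) (βw≢βs ∘ λ eq → trans eq (sym βs≡βy))
           f′→g g→f′
      where
      y∈g = p─q⊆p g f y∈g─f
      y∉f = x∈p─q⇒x∉q g f y∈g─f
      s = proj₁ (g→f y∈g)
      s∈f : s ∈ f
      s∈f = proj₁ (proj₂ (g→f y∈g))
      βs≡βy : β s ≡ β y
      βs≡βy = proj₂ (proj₂ (g→f y∈g))
      f′ = replace f s y
      -- A vertex of f outside the block of s is needed for the exchange to apply, and it keeps the
      -- new edge crossing.
      outsider : ∃ λ w → w ∈ f × β w ≢ β s
      outsider with β a ≟ᶠ β s
      ... | no βa≢βs = a , a∈f , βa≢βs
      ... | yes βa≡βs = b , b∈f , λ βb≡βs → βa≢βb (trans βa≡βs (sym βb≡βs))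
      s∉g : s ∉ g
      s∉g s∈g = y∉f (subst (_∈ f) (g-inj s∈g y∈g βs≡βy) s∈f)
      -- The exchange adds y, which belongs to g, and removes s, which does not.
      measure : g ─ f′ ⊂ g ─ f
      measure =
        (λ {x} x∈ → let x∈g = p─q⊆p g f′ x∈ in x∈p∧x∉q⇒x∈p─q x∈g λ x∈f →
          x∈p─q⇒x∉q g f′ x∈ (∈-replace-old x∈f λ { refl → s∉g x∈g })) ,
        y , y∈g─f , λ y∈ → x∈p─q⇒x∉q g f′ y∈ (∈-replace-new {e = f})
      f′→g : ∀ {x} → x ∈ f′ → ∃ λ y → y ∈ g × β x ≡ β y
      f′→g x∈ with ∈-replace⁻ {e = f} x∈
      ... | inj₁ (x∈f , _) = f→g x∈f
      ... | inj₂ refl = y , y∈g , refl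
      g→f′ : ∀ {y} → y ∈ g → ∃ λ x → x ∈ f′ × β x ≡ β y
      g→f′ u∈g with g→f u∈g
      ... | x , x∈f , βx≡βu with x ≟ᶠ s
      ... | yes refl = y , ∈-replace-new {e = f} , trans (sym βs≡βy) βx≡βu
      ... | no x≢s = x , ∈-replace-old x∈f x≢s , βx≡βu

  preimage : Subset (length P) → Subset (v H)
  preimage 𝓜 = comprehension λ x → β x ∈? 𝓜

  ∈-preimage⁺ : ∀ {𝓜 x} → β x ∈ 𝓜 → x ∈ preimage 𝓜
  ∈-preimage⁺ {𝓜} = ∈-comprehension⁺ (λ x → β x ∈? 𝓜)

  ∈-preimage⁻ : ∀ {𝓜 x} → x ∈ preimage 𝓜 → β x ∈ 𝓜
  ∈-preimage⁻ {𝓜} = ∈-comprehension⁻ (λ x → β x ∈? 𝓜)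

  private
    image : Subset (v H) → Subset (length P)
    image e = comprehension λ i → nonempty? (List.lookup P i ∩ e)

    image-meets : ∀ e → Meets P e (image e)
    image-meets e i = mk⇔ (∈-comprehension⁻ meets) (∈-comprehension⁺ meets)
      where meets = λ i → nonempty? (List.lookup P i ∩ e)

  meets⁺ : ∀ {e 𝓔 x} → Meets P e 𝓔 → x ∈ e → β x ∈ 𝓔
  meets⁺ {x = x} meets x∈e = Equivalence.from (meets (β x)) (x , x∈p∩q⁺ (∈-block x , x∈e))

  meets⁻ : ∀ {e 𝓔 i} → Meets P e 𝓔 → i ∈ 𝓔 → ∃ λ x → x ∈ e × β x ≡ i
  meets⁻ {e} {i = i} meets i∈𝓔 =
    let x , x∈ = Equivalence.to (meets i) i∈𝓔
        x∈B , x∈e = x∈p∩q⁻ (List.lookup P i) e x∈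
    in x , x∈e , β-unique x∈B

  -- An edge e crossing the union of the blocks in 𝓜 induces a quotient edge crossing 𝓜. The
  -- exchange available in the quotient is realised by some edge f, and `transversal-edge` carries f
  -- to the required exchange of e.
  preimage-module : ∀ {𝓜} → IsModule (H / P) 𝓜 → Module H (preimage 𝓜)
  preimage-module {𝓜} isM = record
    { unique = λ Ee x∈e x∈ w∈e w∉ → unique′ Ee x∈e x∈ w∈e w∉
    ; exchange = λ Ee x∈e x∈ w∈e w∉ → exchange′ Ee x∈e x∈ w∈e w∉
    }
    where
    𝓜-mod = fromIsModule (H / P) isM

    module _ {e x w} (Ee : E H e) (x∈e : x ∈ e) (x∈ : x ∈ preimage 𝓜)
             (w∈e : w ∈ e) (w∉ : w ∉ preimage 𝓜) where

      𝓔 = image e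

      βx∈𝓜 : β x ∈ 𝓜
      βx∈𝓜 = ∈-preimage⁻ x∈

      βw∉𝓜 : β w ∉ 𝓜
      βw∉𝓜 = w∉ ∘ ∈-preimage⁺

      βx≢βw : β x ≢ β w
      βx≢βw eq = βw∉𝓜 (subst (_∈ 𝓜) eq βx∈𝓜)

      ∈𝓔 : ∀ {y} → y ∈ e → β y ∈ 𝓔
      ∈𝓔 = meets⁺ (image-meets e)

      E𝓔 : E (H / P) 𝓔
      E𝓔 = 2≤size (∈𝓔 x∈e) (∈𝓔 w∈e) βx≢βw , e , Ee , image-meets e

      unique-block : ∀ {y} → y ∈ e → β y ∈ 𝓜 → β y ≡ β x
      unique-block y∈e = unique 𝓜-mod E𝓔 (∈𝓔 x∈e) βx∈𝓜 (∈𝓔 w∈e) βw∉𝓜 (∈𝓔 y∈e)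

      e-injective : ∀ {x y} → x ∈ e → y ∈ e → β x ≡ β y → x ≡ y
      e-injective = crossing-injective Ee x∈e w∈e βx≢βw

      unique′ : ∀ {y} → y ∈ e → y ∈ preimage 𝓜 → y ≡ x
      unique′ y∈e y∈ = e-injective y∈e x∈e (unique-block y∈e (∈-preimage⁻ y∈))

      exchange′ : ∀ {y} → y ∈ preimage 𝓜 → E H (replace e x y)
      exchange′ {y} y∈ with exchange 𝓜-mod E𝓔 (∈𝓔 x∈e) βx∈𝓜 (∈𝓔 w∈e) βw∉𝓜 (∈-preimage⁻ y∈)
      ... | _ , f , Ef , f-meets =
        -- The block of y is in 𝓜 and that of w is not, so a and b lie in different blocks and f is
        -- crossing.
        let b , b∈f , βb≡βy = meets⁻ f-meets (∈-replace-new {e = 𝓔})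
            a , a∈f , βa≡βw = meets⁻ f-meets (∈-replace-old (∈𝓔 w∈e) (βx≢βw ∘ sym))
        in transversal-edge Ef a∈f b∈f
             (λ βa≡βb → βw∉𝓜 (subst (_∈ 𝓜) (trans (sym βb≡βy) (trans (sym βa≡βb) βa≡βw)) βy∈𝓜))
             g-injective f→g g→f
        where
        g = replace e x y
        βy∈𝓜 = ∈-preimage⁻ y∈

        -- A vertex z of e in the block of y would lie in a block of 𝓜. The only such block met by e
        -- is that of x, so z would be x.
        other-block : ∀ {z} → z ∈ e → z ≢ x → β z ≢ β y
        other-block z∈e z≢x βz≡βy = z≢x
          (e-injective z∈e x∈e (unique-block z∈e (subst (_∈ 𝓜) (sym βz≡βy) βy∈𝓜)))

        g-injective : ∀ {s t} → s ∈ g → t ∈ g → β s ≡ β t → s ≡ t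
        g-injective s∈ t∈ eq with ∈-replace⁻ {e = e} s∈ | ∈-replace⁻ {e = e} t∈
        ... | inj₁ (s∈e , _) | inj₁ (t∈e , _) = e-injective s∈e t∈e eq
        ... | inj₁ (s∈e , s≢x) | inj₂ refl = contradiction eq (other-block s∈e s≢x)
        ... | inj₂ refl | inj₁ (t∈e , t≢x) = contradiction (sym eq) (other-block t∈e t≢x)
        ... | inj₂ refl | inj₂ refl = refl

        f→g : ∀ {s} → s ∈ f → ∃ λ t → t ∈ g × β s ≡ β t
        f→g s∈f with ∈-replace⁻ {e = 𝓔} (meets⁺ f-meets s∈f)
        ... | inj₂ βs≡βy = y , ∈-replace-new {e = e} , βs≡βy
        ... | inj₁ (βs∈𝓔 , βs≢βx) =
          let t , t∈e , βt≡βs = meets⁻ (image-meets e) βs∈𝓔 in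
          t , ∈-replace-old t∈e (λ { refl → βs≢βx (sym βt≡βs) }) , sym βt≡βs

        g→f : ∀ {t} → t ∈ g → ∃ λ s → s ∈ f × β s ≡ β t
        g→f t∈g with ∈-replace⁻ {e = e} t∈g
        ... | inj₂ refl = meets⁻ f-meets (∈-replace-new {e = 𝓔})
        ... | inj₁ (t∈e , t≢x) = meets⁻ f-meets
          (∈-replace-old (∈𝓔 t∈e) λ eq → t≢x (e-injective t∈e x∈e eq))

-- The maximal strong modules as a partition

module _ (H : Hypergraph) (2≤v : 2 ≤ v H) (P : List (Subset (v H))) (P-unique : Unique P)
         (∈-P : ∀ M → M ∈ᴸ P ⇔ IsMaximalStrongModule H M) where

  private
    block : Fin (length P) → Subset (v H)
    block = List.lookup P

  -- This makes the blocks cover V: each singleton extends to a maximal proper strong module.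
  singleton-strong : ∀ x → IsProperStrongModule H ⁅ x ⁆
  singleton-strong x = (toIsModule H mod , strong) , proper
    where
    mod : Module H ⁅ x ⁆
    mod = record
      { unique = λ _ _ x∈ _ _ _ y∈ → trans (x∈⁅y⁆⇒x≡y x y∈) (sym (x∈⁅y⁆⇒x≡y x x∈))
      ; exchange = λ Ee x∈e x∈ _ _ y∈ → subst (E H)
          (sym (trans (cong₂ (replace _) refl (trans (x∈⁅y⁆⇒x≡y x y∈) (sym (x∈⁅y⁆⇒x≡y x x∈))))
                      (replace-self x∈e))) Ee
      }
    strong : ∀ N → IsModule H N → Nonempty (⁅ x ⁆ ∩ N) → ⁅ x ⁆ ⊆ N ⊎ N ⊆ ⁅ x ⁆
    strong N _ (y , y∈) =
      let y∈x , y∈N = x∈p∩q⁻ ⁅ x ⁆ N y∈ in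
      inj₁ λ z∈ → subst (_∈ N) (trans (x∈⁅y⁆⇒x≡y x y∈x) (sym (x∈⁅y⁆⇒x≡y x z∈))) y∈N
    proper : ⁅ x ⁆ ≢ ⊤
    proper eq = <-irrefl (trans (sym (∣⁅x⁆∣≡1 x)) (trans (cong ∣_∣ eq) (∣⊤∣≡n (v H)))) 2≤v

  block-maximal : ∀ i → IsMaximalStrongModule H (block i)
  block-maximal i = Equivalence.to (∈-P (block i)) (∈-lookup i)

  block-module : ∀ i → Module H (block i)
  block-module i = fromIsModule H (proj₁ (proj₁ (proj₁ (block-maximal i))))

  -- Abstract, since with-abstraction would otherwise unfold the search for a
  -- maximal strong module.
  abstract
    strong⊆block : ∀ {M} → IsProperStrongModule H M → ∃ λ i → M ⊆ block i
    strong⊆block {M} M-strong =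
      let N , N-strong , M⊆N , N-max = maximal (isProperStrongModule? H) M M-strong
          N∈P = Equivalence.from (∈-P N)
            (N-strong , λ R R-strong N⊆R → ⊆-antisym (N-max R R-strong N⊆R) N⊆R)
      in index N∈P , subst (M ⊆_) (lookup-index N∈P) M⊆N

  blockOf : Fin (v H) → Fin (length P)
  blockOf x = proj₁ (strong⊆block (singleton-strong x))

  ∈-blockOf : ∀ x → x ∈ block (blockOf x)
  ∈-blockOf x = proj₂ (strong⊆block (singleton-strong x)) (x∈⁅x⁆ x)

  block-⊆ : ∀ {i j} → block i ⊆ block j → i ≡ j
  block-⊆ {i} {j} i⊆j = sym (lookup-injective (P-unique)
    (proj₂ (block-maximal i) (block j) (proj₁ (block-maximal j)) i⊆j))

  block-unique : ∀ {x i j} → x ∈ block i → x ∈ block j → i ≡ j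
  block-unique {i = i} {j} x∈i x∈j with
    proj₂ (proj₁ (proj₁ (block-maximal i))) (block j) (proj₁ (proj₁ (proj₁ (block-maximal j))))
      (_ , x∈p∩q⁺ (x∈i , x∈j))
  ... | inj₁ i⊆j = block-⊆ i⊆j
  ... | inj₂ j⊆i = sym (block-⊆ j⊆i)

  -- An empty block would be contained in the block of some vertex x, hence by maximality be that
  -- block, and so contain x.
  block-nonempty : ∀ i → Nonempty (block i)
  block-nonempty i with nonempty? (block i)
  ... | yes ne = ne
  ... | no empty with size-positive {p = ⊤} (subst (1 ≤_) (sym (∣⊤∣≡n (v H))) (≤-trans (s≤s z≤n) 2≤v))
  ... | x , _ = ⊥-elim (empty (x , subst (λ j → x ∈ block j)
    (sym (block-⊆ {i} {blockOf x} λ y∈i → contradiction (_ , y∈i) empty)) (∈-blockOf x)))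

  blockOf-unique : ∀ {x i} → x ∈ block i → blockOf x ≡ i
  blockOf-unique = block-unique (∈-blockOf _)

  blockOf-strong : ∀ {M x y} → IsProperStrongModule H M → x ∈ M → y ∈ M → blockOf x ≡ blockOf y
  blockOf-strong M-strong x∈M y∈M =
    let i , M⊆i = strong⊆block M-strong in
    trans (blockOf-unique (M⊆i x∈M)) (sym (blockOf-unique (M⊆i y∈M)))

  -- An edge stays inside the component of any of its vertices, and that component, being proper and
  -- strong, lies in one block.
  split-edge⊆block : ∀ {D} → IsSplit H D → ∀ {e x y} → E H e → x ∈ e → y ∈ e → blockOf x ≡ blockOf y
  split-edge⊆block split {x = x} Ee x∈e y∈e =
    let C , x∈C , C-closed , C-strong = component H split x in
    blockOf-strong C-strong x∈C (C-closed _ Ee (x , x∈p∩q⁺ (x∈e , x∈C)) y∈e)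

  toggle-split-edge⊆block : ∀ {D} → IsSplit (toggle H) D →
    ∀ {e x y} → E (toggle H) e → x ∈ e → y ∈ e → blockOf x ≡ blockOf y
  toggle-split-edge⊆block split {x = x} E′e x∈e y∈e =
    let C , x∈C , C-closed , C-strong , C≢⊤ = component (toggle H) split x in
    blockOf-strong (untoggle-strong H C-strong , C≢⊤) x∈C
      (C-closed _ E′e (x , x∈p∩q⁺ (x∈e , x∈C)) y∈e)

  private
    meetsBlock : ∀ {e 𝓔 i} → Meets P e 𝓔 → i ∈ 𝓔 → ∃ λ x → x ∈ e × blockOf x ≡ i
    meetsBlock = meets⁻ H P blockOf ∈-blockOf blockOf-unique block-module

  -- The empty and the complete quotient

  split⇒empty : ∀ {D} → IsSplit H D → IsEmpty (H / P)
  split⇒empty split 𝓔 (2≤𝓔 , e , Ee , meets) =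
    let i , j , i≢j , i∈𝓔 , j∈𝓔 = 2≤size⇒distinct {p = 𝓔} 2≤𝓔
        x , x∈e , βx≡i = meetsBlock meets i∈𝓔
        y , y∈e , βy≡j = meetsBlock meets j∈𝓔
    in i≢j (trans (sym βx≡i) (trans (split-edge⊆block split Ee x∈e y∈e) βy≡j))

  -- Every edge of `toggle H` lies in one block. So an edge of H between blocks must have size 2,
  -- and a pair of vertices from different blocks must be an edge of H.
  toggle-split⇒complete : ∀ {D} → IsSplit (toggle H) D → IsCompleteGraph (H / P)
  toggle-split⇒complete split 𝓔 = mk⇔ size≡2 edge
    where
    cross-pair : ∀ {e x y} → E H e → x ∈ e → y ∈ e → blockOf x ≢ blockOf y → e ≡ pair x y
    cross-pair {e} {x} {y} Ee x∈e y∈e βx≢βy = size≡2⇒pair {p = e}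
      (decidable-stable (∣ e ∣ ≟ⁿ 2) λ e≢2 →
        βx≢βy (toggle-split-edge⊆block split (inj₂ (e≢2 , Ee)) x∈e y∈e))
      x∈e y∈e λ { refl → βx≢βy refl }

    size≡2 : E (H / P) 𝓔 → ∣ 𝓔 ∣ ≡ 2
    size≡2 (2≤𝓔 , e , Ee , meets) =
      let i , j , i≢j , i∈𝓔 , j∈𝓔 = 2≤size⇒distinct {p = 𝓔} 2≤𝓔
          x , x∈e , βx≡i = meetsBlock meets i∈𝓔
          y , y∈e , βy≡j = meetsBlock meets j∈𝓔
          e≡pair = cross-pair Ee x∈e y∈e
            (λ βx≡βy → i≢j (trans (sym βx≡i) (trans βx≡βy βy≡j)))
          inPair : ∀ {l} → l ∈ 𝓔 → l ≡ i ⊎ l ≡ j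
          inPair l∈𝓔 =
            let z , z∈e , βz≡l = meetsBlock meets l∈𝓔 in
            [ (λ z≡x → inj₁ (trans (sym βz≡l) (trans (cong blockOf z≡x) βx≡i)))
            , (λ z≡y → inj₂ (trans (sym βz≡l) (trans (cong blockOf z≡y) βy≡j)))
            ]′ (∈-pair⁻ {x = x} {y} (subst (z ∈_) e≡pair z∈e))
      in trans (cong ∣_∣ (≡-pair {p = 𝓔} i∈𝓔 j∈𝓔 inPair)) (size-pair {x = i} {j} i≢j)

    edge : ∣ 𝓔 ∣ ≡ 2 → E (H / P) 𝓔
    edge 𝓔≡2 with 2≤size⇒distinct {p = 𝓔} (≤-reflexive (sym 𝓔≡2))
    ... | i , j , i≢j , i∈𝓔 , j∈𝓔 with block-nonempty i | block-nonempty j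
    ... | x , x∈i | y , y∈j = ≤-reflexive (sym 𝓔≡2) , pair x y , pair-edge , meets
      where
      pair-edge : E H (pair x y)
      pair-edge = decidable-stable (E? H (pair x y)) λ ¬E → i≢j (trans (sym (blockOf-unique x∈i))
        (trans (toggle-split-edge⊆block split {pair x y}
                 (inj₁ (size-pair {x = x} {y} (λ { refl → i≢j (block-unique x∈i y∈j) }) , ¬E))
                 ∈-pairˡ (∈-pairʳ {x = x}))
               (blockOf-unique y∈j)))

      meets : Meets P (pair x y) 𝓔
      meets l = mk⇔ to from
        where
        to : l ∈ 𝓔 → Nonempty (block l ∩ pair x y)
        to l∈𝓔 with ∈-pair⁻ (subst (l ∈_) (size≡2⇒pair {p = 𝓔} 𝓔≡2 i∈𝓔 j∈𝓔 i≢j) l∈𝓔)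
        ... | inj₁ refl = x , x∈p∩q⁺ (x∈i , ∈-pairˡ)
        ... | inj₂ refl = y , x∈p∩q⁺ (y∈j , ∈-pairʳ {x = x})
        from : Nonempty (block l ∩ pair x y) → l ∈ 𝓔
        from (z , z∈) with x∈p∩q⁻ (block l) (pair x y) z∈
        ... | z∈l , z∈pair with ∈-pair⁻ z∈pair
        ... | inj₁ refl = subst (_∈ 𝓔) (block-unique x∈i z∈l) i∈𝓔
        ... | inj₂ refl = subst (_∈ 𝓔) (block-unique y∈j z∈l) j∈𝓔

  -- The prime quotient

  module _ (¬split : ¬ ∃ (IsSplit H)) (¬toggle-split : ¬ ∃ (IsSplit (toggle H))) where

    ¬complementary : ∀ {M} → Module H M → Module H (∁ M) → Nonempty M → ¬ Nonempty (∁ M)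
    ¬complementary mod mod-∁ ne ne-∁ with complementary⇒closed H mod mod-∁
    ... | inj₁ closed = ¬split (_ , closed , ne , ne-∁)
    ... | inj₂ closed = ¬toggle-split (_ , closed , ne , ne-∁)

    maximal⇒strong : ∀ {M} → IsModule H M × M ≢ ⊤ →
      (∀ N → IsModule H N × N ≢ ⊤ → M ⊆ N → N ⊆ M) → IsStrongModule H M
    maximal⇒strong {M} (M-isM , M≢⊤) M-max = M-isM , strong
      where
      M-mod = fromIsModule H M-isM
      strong : ∀ N → IsModule H N → Nonempty (M ∩ N) → M ⊆ N ⊎ N ⊆ M
      strong N N-isM (x , x∈) with M ⊆? N | N ⊆? M
      ... | yes M⊆N | _ = inj₁ M⊆N
      ... | no _ | yes N⊆M = inj₂ N⊆M
      ... | no M⊈N | no N⊈M =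
        let w , w∈M , w∉N = ⊈⇒∃ M⊈N
            y , y∈N , y∉M = ⊈⇒∃ N⊈M
        in ⊥-elim (¬complementary M-mod
             (complement-module H M-mod N-mod ∁M⊆N w∈M w∉N) (w , w∈M) (y , x∉p⇒x∈∁p y∉M))
        where
        N-mod = fromIsModule H N-isM
        -- The union of overlapping modules is a module. If it were proper, maximality of M would
        -- give N ⊆ M.
        M∪N≡⊤ : M ∪ N ≡ ⊤
        M∪N≡⊤ = decidable-stable ((M ∪ N) ≟ˢ ⊤) λ M∪N≢⊤ → N⊈M
          (M-max (M ∪ N) (toIsModule H (union-module H M-mod N-mod (x , x∈)) , M∪N≢⊤) (p⊆p∪q N)
            ∘ q⊆p∪q M N)
        ∁M⊆N : ∁ M ⊆ N
        ∁M⊆N {z} z∈∁ with x∈p∪q⁻ M N (subst (z ∈_) (sym M∪N≡⊤) ∈⊤)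
        ... | inj₁ z∈M = contradiction z∈M (x∈∁p⇒x∉p z∈∁)
        ... | inj₂ z∈N = z∈N

    -- If the blocks i and j covered V, then either i = j and that block is not proper, or the two
    -- are complementary modules. Allowing i = j lets `3≤blocks` obtain the second block in the same
    -- way as the third.
    third-block : ∀ i j → ∃ λ l → l ≢ i × l ≢ j
    third-block i j with nonempty? (∁ (block i ∪ block j))
    ... | yes (z , z∈∁) = blockOf z
        , (λ { refl → x∈∁p⇒x∉p z∈∁ (p⊆p∪q (block j) (∈-blockOf z)) })
        , (λ { refl → x∈∁p⇒x∉p z∈∁ (q⊆p∪q (block i) (block j) (∈-blockOf z)) })
    ... | no empty with i ≟ᶠ j
    ... | yes refl = ⊥-elim (proj₂ (proj₁ (block-maximal i)) (⊆-antisym ⊆⊤ λ {z} _ →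
            decidable-stable (z ∈? block i) λ z∉i → empty (z , x∉p⇒x∈∁p λ z∈ →
              [ z∉i , z∉i ]′ (x∈p∪q⁻ (block i) (block i) z∈))))
    ... | no i≢j = ⊥-elim (¬complementary (block-module i)
            (subst (Module H) j≡∁i (block-module j)) (block-nonempty i)
            (subst Nonempty j≡∁i (block-nonempty j)))
      where
      j≡∁i : block j ≡ ∁ (block i)
      j≡∁i = ⊆-antisym
        (λ z∈j → x∉p⇒x∈∁p λ z∈i → i≢j (block-unique z∈i z∈j))
        (λ {z} z∈∁ → decidable-stable (z ∈? block j) λ z∉j → empty (z , x∉p⇒x∈∁p λ z∈ →
          [ x∈∁p⇒x∉p z∈∁ , z∉j ]′ (x∈p∪q⁻ (block i) (block j) z∈)))

    3≤blocks : 3 ≤ length P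
    3≤blocks with size-positive {p = ⊤} (subst (1 ≤_) (sym (∣⊤∣≡n (v H))) (≤-trans (s≤s z≤n) 2≤v))
    ... | x , _ with third-block (blockOf x) (blockOf x)
    ... | j , j≢i , _ with third-block (blockOf x) j
    ... | l , l≢i , l≢j = subst (3 ≤_) (∣⊤∣≡n _) (3≤size {p = ⊤} ∈⊤ ∈⊤ ∈⊤ l≢i l≢j (j≢i ∘ sym))

    ¬split⇒prime : IsPrime (H / P)
    ¬split⇒prime = 3≤blocks , trivial
      where
      trivial : ∀ 𝓜 → IsModule (H / P) 𝓜 → IsTrivial 𝓜
      trivial 𝓜 𝓜-isM with nonempty? 𝓜 | 𝓜 ≟ˢ ⊤
      ... | no empty | _ = inj₁ (Empty-unique empty)
      ... | yes _ | yes 𝓜≡⊤ = inj₂ (inj₁ 𝓜≡⊤)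
      ... | yes (i , i∈𝓜) | no 𝓜≢⊤ = inj₂ (inj₂ (i , ⊆-antisym
              (λ j∈𝓜 → subst (_∈ ⁅ i ⁆) (same-block i∈𝓜 j∈𝓜) (x∈⁅x⁆ i))
              (λ j∈ → subst (_∈ 𝓜) (sym (x∈⁅y⁆⇒x≡y i j∈)) i∈𝓜)))
        where
        M = preimage H P blockOf ∈-blockOf blockOf-unique block-module 𝓜

        ∈M : ∀ {j x} → j ∈ 𝓜 → x ∈ block j → x ∈ M
        ∈M j∈𝓜 x∈j = ∈-preimage⁺ H P blockOf ∈-blockOf blockOf-unique block-module
          (subst (_∈ 𝓜) (sym (blockOf-unique x∈j)) j∈𝓜)

        M≢⊤ : M ≢ ⊤
        M≢⊤ M≡⊤ = 𝓜≢⊤ (⊆-antisym ⊆⊤ λ {j} _ →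
          let x , x∈j = block-nonempty j in
          subst (_∈ 𝓜) (blockOf-unique x∈j)
            (∈-preimage⁻ H P blockOf ∈-blockOf blockOf-unique block-module
              (subst (x ∈_) (sym M≡⊤) ∈⊤)))

        -- M extends to a maximal proper module. That module is strong, so it lies in a single
        -- block, which leaves 𝓜 only one member.
        same-block : ∀ {j l} → j ∈ 𝓜 → l ∈ 𝓜 → j ≡ l
        same-block {j} {l} j∈𝓜 l∈𝓜 =
          let N , N-proper , M⊆N , N-max = maximal (λ N → isModule? H N ×-dec ¬? (N ≟ˢ ⊤)) M
                (toIsModule H (preimage-module H P blockOf ∈-blockOf blockOf-unique block-module 𝓜-isM)
                , M≢⊤)
              x , x∈j = block-nonempty j
              y , y∈l = block-nonempty l
          in trans (sym (blockOf-unique x∈j)) (trans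
               (blockOf-strong (maximal⇒strong N-proper N-max , proj₂ N-proper)
                 (M⊆N (∈M j∈𝓜 x∈j)) (M⊆N (∈M l∈𝓜 y∈l)))
               (blockOf-unique y∈l))

  -- Assembling the three cases

  trichotomy : Dec (∃ (IsSplit H)) → Dec (∃ (IsSplit (toggle H))) →
    IsEmpty (H / P) ⊎ IsPrime (H / P) ⊎ IsCompleteGraph (H / P)
  trichotomy (yes (_ , split)) _ = inj₁ (split⇒empty split)
  trichotomy (no _) (yes (_ , split)) = inj₂ (inj₂ (toggle-split⇒complete split))
  trichotomy (no ¬split) (no ¬toggle-split) = inj₂ (inj₁ (¬split⇒prime ¬split ¬toggle-split))

theorem7 : (H : Hypergraph) → 2 ≤ v H →
    IsEmpty (H / Π H) ⊎ IsPrime (H / Π H) ⊎ IsCompleteGraph (H / Π H)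
theorem7 H 2≤v = trichotomy H 2≤v (Π H) (Π-unique H) (∈-Π H)
  (anySubset? (isSplit? H)) (anySubset? (isSplit? (toggle H)))
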